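{- Let $G$ be a finite abelian group and let $D\subset G$ be a $(v,k,\lambda)$-difference set with $k-\lambda>1$. Let $Y$ be the $k\times v$ Youden square with rows indexed by $i\in D$, columns indexed by $j\in G$, and entries $Y(i,j)=ij$. Suppose that, for some column $C$ of $Y$, the array $Y^{[C]}$, obtained from $Y$ by deleting the column $C$ and deleting (leaving the cell empty) every occurrence in the remaining columns of a symbol that appears in $C$, is the RL form of a triple array. Then $D$ admits $-1$ as a multiplier.
   Context: Groups are written multiplicatively. A $k$-subset $D$ of a finite group $G$ of order $v$ is a $(v,k,\lambda)$-difference set if every non-identity element of $G$ can be written in exactly $\lambda$ ways as $xy^{ -1}$ with $x,y\in D$. For $G$ abelian, $-1$ is a multiplier of $D$ if $D^{(-1)}:=\{x^{ -1}:x\in D\}$ equals a translate $Dg=\{xg:x\in D\}$ of $D$ for some $g\in G$. The RL form of a triple array is what one obtains from a triple array by interchanging the roles of columns and symbols. Explicitly, it is an array with some cells possibly empty, with no symbol repeated in any row or column, such that for some constants $\kappa,\lambda_{rr},\lambda_{cc},\lambda_{rc}$: (RTA1) every column has exactly $\kappa$ occupied cells; (RTA2) for any two distinct rows there are exactly $\lambda_{rr}$ columns in which both rows are occupied; (RTA3) every pair of distinct symbols occurs together in exactly $\lambda_{cc}$ columns; (RTA4) for every row $i$, the columns whose cell in row $i$ is occupied together contain every symbol exactly $\lambda_{rc}$ times. For $Y^{[C]}$ the rows are indexed by $D$, the columns by the $v-1$ elements of $G$ other than the index of $C$, and the symbol set is the set of the $v-k$ elements of $G$ not appearing in $C$. 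-}

module Defs where

open import Algebra.Bundles using (AbelianGroup)
open import Data.List.Base using (List; []; _∷_; length; filter; cartesianProduct)
open import Data.List.Relation.Unary.All using (All; []; _∷_)
open import Data.List.Relation.Unary.AllPairs using ([]; _∷_)
open import Data.List.Relation.Unary.Any as Any using (here; there)
open import Data.List.Relation.Unary.Enumerates.Setoid using (IsEnumeration)
open import Data.List.Relation.Unary.Unique.Setoid using (Unique)
import Data.List.Membership.Setoid as Membership
open import Data.Maybe.Base using (Maybe; just; nothing)
open import Data.Maybe.Relation.Binary.Pointwise using (Pointwise; just; nothing)
import Data.Maybe.Relation.Unary.Any as MaybeAny
open import Data.Maybe using (Is-just)
open import Data.Nat.Base using (ℕ)
open import Data.Product.Base using (Σ; ∃; _×_; _,_; proj₁)
open import Data.Unit.Base using (tt)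
open import Level using (Level; _⊔_; suc)
open import Relation.Binary.Bundles using (Setoid)
open import Relation.Binary.Definitions using (_Respects_) renaming (Decidable to Decidable₂)
open import Relation.Binary.PropositionalEquality.Core using (_≡_)
open import Relation.Nullary.Decidable using (Dec; yes; no; _×-dec_; ¬?; map′)
open import Relation.Nullary.Negation using (¬_; contradiction)
open import Relation.Unary using (Pred; Decidable; _≐_)
import Relation.Binary.Construct.On as On

private
  variable
    a p c ℓ r ℓr q ℓq s ℓs : Level
    A : Set a

------------------------------------------------------------------------
-- Finite sets and counting

count : {P : Pred A p} → Decidable P → List A → ℕ
count P? xs = length (filter P? xs)

-- `elements` lists every element exactly once up to ≈, so that
-- `count P? elements` is the number of elements satisfying P.
record IsFinite (S : Setoid c ℓ) : Set (c ⊔ ℓ) where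
  open Setoid S
  field
    _≟_        : Decidable₂ _≈_
    elements   : List Carrier
    enumerates : IsEnumeration S elements
    unique     : Unique S elements

  order : ℕ
  order = length elements

record FiniteSetoid (c ℓ : Level) : Set (suc (c ⊔ ℓ)) where
  field
    setoid   : Setoid c ℓ
    isFinite : IsFinite setoid
  open Setoid setoid public
  open IsFinite isFinite public

record DecSubset (S : Setoid c ℓ) (p : Level) : Set (c ⊔ ℓ ⊔ suc p) where
  open Setoid S
  field
    Member  : Pred Carrier p
    resp    : Member Respects _≈_
    member? : Decidable Member

module _ (F : FiniteSetoid c ℓ) where
  open FiniteSetoid F

  ∃? : {P : Pred Carrier p} → P Respects _≈_ → Decidable P → Dec (∃ P)
  ∃? resp P? = map′ Any.satisfied
    (λ (x , px) → Any.map (λ x≈y → resp x≈y px) (enumerates x))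
    (Any.any? P? elements)

module _ (F : FiniteSetoid c ℓ) (D : DecSubset (FiniteSetoid.setoid F) p) where
  open FiniteSetoid F
  open DecSubset D

  subsetSetoid : Setoid (c ⊔ p) ℓ
  subsetSetoid = On.setoid {B = Σ Carrier Member} setoid proj₁

  members : List Carrier → List (Σ Carrier Member)
  members []       = []
  members (x ∷ xs) with member? x
  ... | yes mx = (x , mx) ∷ members xs
  ... | no  _  = members xs

  members-complete : ∀ x {xs} → Membership._∈_ setoid (proj₁ x) xs →
                     Membership._∈_ subsetSetoid x (members xs)
  members-complete (x , mx) {y ∷ ys} x∈ with member? y | x∈
  ... | yes _  | here x≈y = here x≈y
  ... | yes _  | there i  = there (members-complete (x , mx) i)
  ... | no ¬my | here x≈y = contradiction (resp x≈y mx) ¬my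
  ... | no _   | there i  = members-complete (x , mx) i

  members-all : ∀ {x xs} → All (λ y → ¬ (x ≈ y)) xs →
                All (λ y → ¬ (x ≈ proj₁ y)) (members xs)
  members-all [] = []
  members-all {xs = y ∷ _} (x≉y ∷ rest) with member? y
  ... | yes _ = x≉y ∷ members-all rest
  ... | no  _ = members-all rest

  members-unique : ∀ {xs} → Unique setoid xs → Unique subsetSetoid (members xs)
  members-unique [] = []
  members-unique {x ∷ _} (x∉ ∷ rest) with member? x
  ... | yes _ = members-all x∉ ∷ members-unique rest
  ... | no  _ = members-unique rest

  -- A decidable subset as a finite set in its own right; the membership
  -- proof plays no role in its equality.
  subset : FiniteSetoid (c ⊔ p) ℓ
  subset = record
    { setoid   = subsetSetoid
    ; isFinite = record
      { _≟_        = λ x y → proj₁ x ≟ proj₁ y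
      ; elements   = members elements
      ; enumerates = λ x → members-complete x (enumerates (proj₁ x))
      ; unique     = members-unique unique
      }
    }

------------------------------------------------------------------------
-- Arrays with possibly empty cells

record Array (Row : FiniteSetoid r ℓr) (Col : FiniteSetoid q ℓq)
             (Sym : FiniteSetoid s ℓs) : Set (r ⊔ ℓr ⊔ q ⊔ ℓq ⊔ s ⊔ ℓs) where
  private
    module R = FiniteSetoid Row
    module C = FiniteSetoid Col
    module S = FiniteSetoid Sym
  field
    cell      : R.Carrier → C.Carrier → Maybe S.Carrier
    cell-cong : ∀ {i i′ j j′} → i R.≈ i′ → j C.≈ j′ →
                Pointwise S._≈_ (cell i j) (cell i′ j′)

  Occupied : R.Carrier → C.Carrier → Set s
  Occupied i j = Is-just (cell i j)

  occupied? : ∀ i j → Dec (Occupied i j)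
  occupied? i j = MaybeAny.dec (λ _ → yes tt) (cell i j)

  Contains : R.Carrier → C.Carrier → S.Carrier → Set (s ⊔ ℓs)
  Contains i j x = MaybeAny.Any (S._≈ x) (cell i j)

  contains? : ∀ i j x → Dec (Contains i j x)
  contains? i j x = MaybeAny.dec (S._≟ x) (cell i j)

  Appears : C.Carrier → S.Carrier → Set (r ⊔ s ⊔ ℓs)
  Appears j x = ∃ λ i → Contains i j x

  appears? : ∀ j x → Dec (Appears j x)
  appears? j x = ∃? Row
    (λ i≈i′ → transport (cell-cong i≈i′ C.refl))
    (λ i → contains? i j x)
    where
    transport : ∀ {m m′} → Pointwise S._≈_ m m′ →
                MaybeAny.Any (S._≈ x) m → MaybeAny.Any (S._≈ x) m′
    transport (just y≈z) (MaybeAny.just y≈x) =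
      MaybeAny.just (S.trans (S.sym y≈z) y≈x)

  Appears-resp : ∀ j → Appears j Respects S._≈_
  Appears-resp j x≈y (i , i∋x) = i , MaybeAny.map (λ z≈x → S.trans z≈x x≈y) i∋x

record IsRLTripleArray {Row : FiniteSetoid r ℓr} {Col : FiniteSetoid q ℓq}
                       {Sym : FiniteSetoid s ℓs} (M : Array Row Col Sym)
                       : Set (r ⊔ ℓr ⊔ q ⊔ ℓq ⊔ s ⊔ ℓs) where
  private
    module R = FiniteSetoid Row
    module C = FiniteSetoid Col
    module S = FiniteSetoid Sym
  open Array M
  field
    row-distinct : ∀ {i j j′ x} → Contains i j x → Contains i j′ x → j C.≈ j′
    col-distinct : ∀ {i i′ j x} → Contains i j x → Contains i′ j x → i R.≈ i′

    κ λrr λcc λrc : ℕ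

    RTA1 : ∀ j → count (λ i → occupied? i j) R.elements ≡ κ
    RTA2 : ∀ i i′ → ¬ (i R.≈ i′) →
           count (λ j → occupied? i j ×-dec occupied? i′ j) C.elements ≡ λrr
    RTA3 : ∀ x y → ¬ (x S.≈ y) →
           count (λ j → appears? j x ×-dec appears? j y) C.elements ≡ λcc
    -- counts the cells (i′ , j) containing x, with j ranging over the
    -- columns that are occupied in row i
    RTA4 : ∀ i x →
           count (λ (i′ , j) → occupied? i j ×-dec contains? i′ j x)
                 (cartesianProduct R.elements C.elements) ≡ λrc

module _ {Row : FiniteSetoid r ℓr} {Col : FiniteSetoid q ℓq}
         {Sym : FiniteSetoid s ℓs} (M : Array Row Col Sym)
         (j₀ : FiniteSetoid.Carrier Col) where
  private
    module R = FiniteSetoid Row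
    module C = FiniteSetoid Col
    module S = FiniteSetoid Sym
  open Array M

  OtherCols : FiniteSetoid (q ⊔ ℓq) ℓq
  OtherCols = subset Col record
    { Member  = λ j → ¬ (j C.≈ j₀)
    ; resp    = λ j≈j′ j≉j₀ j′≈j₀ → j≉j₀ (C.trans j≈j′ j′≈j₀)
    ; member? = λ j → ¬? (j C.≟ j₀)
    }

  OtherSyms : FiniteSetoid (s ⊔ (r ⊔ s ⊔ ℓs)) ℓs
  OtherSyms = subset Sym record
    { Member  = λ x → ¬ Appears j₀ x
    ; resp    = λ x≈y x∉ y∈ → x∉ (Appears-resp j₀ (S.sym x≈y) y∈)
    ; member? = λ x → ¬? (appears? j₀ x)
    }

  private
    module O = FiniteSetoid OtherSyms

  erase : Maybe S.Carrier → Maybe O.Carrier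
  erase nothing = nothing
  erase (just x) with appears? j₀ x
  ... | yes _  = nothing
  ... | no  x∉ = just (x , x∉)

  erase-cong : ∀ {m m′} → Pointwise S._≈_ m m′ →
               Pointwise O._≈_ (erase m) (erase m′)
  erase-cong nothing = nothing
  erase-cong (just {x} {y} x≈y) with appears? j₀ x | appears? j₀ y
  ... | yes _  | yes _  = nothing
  ... | yes x∈ | no y∉  = contradiction (Appears-resp j₀ x≈y x∈) y∉
  ... | no x∉  | yes y∈ = contradiction (Appears-resp j₀ (S.sym x≈y) y∈) x∉
  ... | no _   | no _   = just x≈y

  -- M^[C] for the column C of M with index j₀.
  deleteColumn : Array Row OtherCols OtherSyms
  deleteColumn = record
    { cell      = λ i (j , _) → erase (cell i j)
    ; cell-cong = λ i≈i′ j≈j′ → erase-cong (cell-cong i≈i′ j≈j′)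
    }

------------------------------------------------------------------------
-- Difference sets in finite abelian groups

module _ (G : AbelianGroup c ℓ) where
  open AbelianGroup G

  inverses : Pred Carrier p → Pred Carrier (c ⊔ ℓ ⊔ p)
  inverses D z = ∃ λ x → D x × z ≈ x ⁻¹

  translate : Pred Carrier p → Carrier → Pred Carrier (c ⊔ ℓ ⊔ p)
  translate D g z = ∃ λ x → D x × z ≈ x ∙ g

  MinusOneIsMultiplier : DecSubset setoid p → Set (c ⊔ ℓ ⊔ p)
  MinusOneIsMultiplier D = ∃ λ g → inverses Member ≐ translate Member g
    where open DecSubset D

  module _ (finite : IsFinite setoid) (D : DecSubset setoid p) where
    open IsFinite finite
    open DecSubset D

    record IsDifferenceSet (v k lam : ℕ) : Set (c ⊔ ℓ) where
      field
        order≡v     : order ≡ v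
        size≡k      : count member? elements ≡ k
        differences : ∀ g → ¬ (g ≈ ε) →
          count (λ (x , y) → (member? x ×-dec member? y) ×-dec (g ≟ (x ∙ y ⁻¹)))
                (cartesianProduct elements elements) ≡ lam

    private
      F : FiniteSetoid c ℓ
      F = record { setoid = setoid ; isFinite = finite }

    youdenSquare : Array (subset F D) F F
    youdenSquare = record
      { cell      = λ (i , _) j → just (i ∙ j)
      ; cell-cong = λ i≈i′ j≈j′ → just (∙-cong i≈i′ j≈j′)
      }

{-# OPTIONS --safe #-}

-- If some g is not of the form i·y with i ∈ D and y ∉ D, then i ↦ i⁻¹g maps D
-- to itself, so D⁽⁻¹⁾ = Dg⁻¹.  Otherwise RTA4, applied to the row i and the
-- symbol yC, says for every g = i·y that W(g) = #{x ∈ D : gx⁻¹ ∉ D} equals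
-- λrc.  Hence T(h) = #{(x , y) ∈ D² : hxy⁻¹ ∉ D} = Σ_{x ∈ D} W(hx) does not
-- depend on h.  Sorting the pairs by the quotient q = xy⁻¹ instead gives
-- T(h) as the number of q with hq ∉ D, weighted by k at q = ε and by λ
-- elsewhere.  Comparing some h ∈ D with some h ∉ D forces k = λ.
module Submission where

open import Defs
open import Algebra.Bundles using (AbelianGroup)
open import Data.Nat.Base using (ℕ; suc; _+_; _*_; _∸_; _>_)
open import Data.Nat.Properties
  using (+-assoc; +-identityʳ; +-cancelˡ-≡; *-assoc; *-comm; *-identityˡ; *-zeroʳ;
         *-distribˡ-+; ≤-trans; ≤-reflexive; n∸n≡0)
open import Data.List.Base using (List; []; _∷_; _++_; map; cartesianProduct)
open import Data.List.Relation.Unary.All using (All; []; _∷_)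
open import Data.List.Relation.Unary.AllPairs using ([]; _∷_)
open import Data.List.Relation.Unary.Any using (here; there)
open import Data.List.Relation.Unary.Unique.Setoid using (Unique)
import Data.List.Membership.Setoid as Membership
import Data.Maybe.Relation.Unary.Any as MaybeAny
open import Data.Nat.Tactic.RingSolver using (solve-∀)
open import Data.Product.Base using (∃; _×_; _,_; proj₁; proj₂)
open import Data.Unit.Base using (tt)
open import Function.Base using (_∘_)
open import Level using (Level)
open import Relation.Binary.PropositionalEquality
  using (_≡_; refl; sym; trans; cong; cong₂; module ≡-Reasoning)
open import Relation.Nullary.Decidable
  using (Dec; yes; no; _×-dec_; ¬?; decidable-stable)
open import Relation.Nullary.Negation using (¬_; contradiction)
open import Relation.Unary using (Pred; Decidable)
import Algebra.Properties.AbelianGroup as AbelianGroupProperties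
import Algebra.Properties.CommutativeSemigroup as CommutativeSemigroupProperties
import Relation.Binary.Reasoning.Setoid as SetoidReasoning

private
  variable
    a c ℓ p : Level
    A B : Set a
    P Q : Set p

-- Indicators of decidable propositions and sums over lists.

𝟙 : Dec P → ℕ
𝟙 (yes _) = 1
𝟙 (no  _) = 0

𝟙-yes : (P? : Dec P) → P → 𝟙 P? ≡ 1
𝟙-yes (yes _) _ = refl
𝟙-yes (no ¬p) p = contradiction p ¬p

𝟙-no : (P? : Dec P) → ¬ P → 𝟙 P? ≡ 0
𝟙-no (yes p) ¬p = contradiction p ¬p
𝟙-no (no _)  _  = refl

𝟙-cong : (P? : Dec P) (Q? : Dec Q) → (P → Q) → (Q → P) → 𝟙 P? ≡ 𝟙 Q?
𝟙-cong (yes p) Q? f _ = sym (𝟙-yes Q? (f p))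
𝟙-cong (no ¬p) Q? _ g = sym (𝟙-no Q? (¬p ∘ g))

𝟙-× : (P? : Dec P) (Q? : Dec Q) → 𝟙 (P? ×-dec Q?) ≡ 𝟙 P? * 𝟙 Q?
𝟙-× (yes _) (yes _) = refl
𝟙-× (yes _) (no _)  = refl
𝟙-× (no _)  _       = refl

𝟙-idem : (P? : Dec P) → 𝟙 P? * 𝟙 P? ≡ 𝟙 P?
𝟙-idem (yes _) = refl
𝟙-idem (no _)  = refl

∑ : List A → (A → ℕ) → ℕ
∑ []       f = 0
∑ (x ∷ xs) f = f x + ∑ xs f

∑-cong : ∀ {f g : A → ℕ} (xs : List A) → (∀ x → f x ≡ g x) → ∑ xs f ≡ ∑ xs g
∑-cong []       f≗g = refl
∑-cong (x ∷ xs) f≗g = cong₂ _+_ (f≗g x) (∑-cong xs f≗g)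

∑-zero : (xs : List A) → ∑ xs (λ _ → 0) ≡ 0
∑-zero []       = refl
∑-zero (_ ∷ xs) = ∑-zero xs

∑-distrib-+ : ∀ (f g : A → ℕ) (xs : List A) →
              ∑ xs (λ x → f x + g x) ≡ ∑ xs f + ∑ xs g
∑-distrib-+ f g []       = refl
∑-distrib-+ f g (x ∷ xs) = begin
  f x + g x + ∑ xs (λ y → f y + g y) ≡⟨ cong (f x + g x +_) (∑-distrib-+ f g xs) ⟩
  f x + g x + (∑ xs f + ∑ xs g)      ≡⟨ interchange (f x) (g x) (∑ xs f) (∑ xs g) ⟩
  f x + ∑ xs f + (g x + ∑ xs g)      ∎
  where
  open ≡-Reasoning
  interchange : ∀ k l m n → k + l + (m + n) ≡ k + m + (l + n)
  interchange = solve-∀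

*-distribˡ-∑ : ∀ n (f : A → ℕ) (xs : List A) → ∑ xs (λ x → n * f x) ≡ n * ∑ xs f
*-distribˡ-∑ n f []       = sym (*-zeroʳ n)
*-distribˡ-∑ n f (x ∷ xs) = trans (cong (n * f x +_) (*-distribˡ-∑ n f xs))
                                  (sym (*-distribˡ-+ n (f x) (∑ xs f)))

∑-swap : ∀ (f : A → B → ℕ) (xs : List A) (ys : List B) →
         ∑ xs (λ x → ∑ ys (f x)) ≡ ∑ ys (λ y → ∑ xs (λ x → f x y))
∑-swap f []       ys = sym (∑-zero ys)
∑-swap f (x ∷ xs) ys = trans (cong (∑ ys (f x) +_) (∑-swap f xs ys))
                             (sym (∑-distrib-+ (f x) _ ys))

∑-map : ∀ (f : B → ℕ) (h : A → B) (xs : List A) → ∑ (map h xs) f ≡ ∑ xs (f ∘ h)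
∑-map f h []       = refl
∑-map f h (x ∷ xs) = cong (f (h x) +_) (∑-map f h xs)

∑-++ : ∀ (f : A → ℕ) (xs ys : List A) → ∑ (xs ++ ys) f ≡ ∑ xs f + ∑ ys f
∑-++ f []       ys = refl
∑-++ f (x ∷ xs) ys = trans (cong (f x +_) (∑-++ f xs ys))
                           (sym (+-assoc (f x) (∑ xs f) (∑ ys f)))

∑-cartesianProduct : ∀ (f : A × B → ℕ) (xs : List A) (ys : List B) →
  ∑ (cartesianProduct xs ys) f ≡ ∑ xs (λ x → ∑ ys (λ y → f (x , y)))
∑-cartesianProduct f []       ys = refl
∑-cartesianProduct f (x ∷ xs) ys =
  trans (∑-++ f (map (x ,_) ys) (cartesianProduct xs ys))
        (cong₂ _+_ (∑-map f (x ,_) ys) (∑-cartesianProduct f xs ys))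

-- The bridge from the counts in the definitions to sums of indicators, which can be swapped,
-- factored and regrouped.
count≡∑ : {P : Pred A p} (P? : Decidable P) (xs : List A) →
          count P? xs ≡ ∑ xs (λ x → 𝟙 (P? x))
count≡∑ P? []       = refl
count≡∑ P? (x ∷ xs) with P? x
... | yes _ = cong suc (count≡∑ P? xs)
... | no  _ = count≡∑ P? xs

-- Sums over a finite set and over its decidable subsets.

module _ (F : FiniteSetoid c ℓ) where
  open FiniteSetoid F renaming (refl to ≈-refl; sym to ≈-sym; trans to ≈-trans)

  -- Exactly one listed element matches `y`, but only up to `≈`, hence the congruence condition on
  -- `f`. Read forwards it collapses a sum; read backwards it introduces a new summation variable.
  ∑-δ : ∀ (f : Carrier → ℕ) → (∀ {x y} → x ≈ y → f x ≡ f y) →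
        ∀ y → ∑ elements (λ x → 𝟙 (x ≟ y) * f x) ≡ f y
  ∑-δ f f-cong y = present unique (enumerates y)
    where
    -- Covers the tail after the match: by uniqueness nothing there can match `y` again.
    absent : ∀ {x xs} → x ≈ y → All (λ z → ¬ (x ≈ z)) xs →
             ∑ xs (λ x → 𝟙 (x ≟ y) * f x) ≡ 0
    absent x≈y [] = refl
    absent {xs = z ∷ _} x≈y (x≉z ∷ x∉) =
      cong₂ _+_ (cong (_* f z) (𝟙-no (z ≟ y) (λ z≈y → x≉z (≈-trans x≈y (≈-sym z≈y)))))
                (absent x≈y x∉)

    present : ∀ {xs} → Unique setoid xs → Membership._∈_ setoid y xs →
              ∑ xs (λ x → 𝟙 (x ≟ y) * f x) ≡ f y
    present {x ∷ xs} (x∉ ∷ u) y∈ with x ≟ y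
    present {x ∷ xs} (x∉ ∷ u) y∈         | yes x≈y =
      trans (cong₂ _+_ (trans (*-identityˡ (f x)) (f-cong x≈y)) (absent x≈y x∉))
            (+-identityʳ (f y))
    present {x ∷ xs} (x∉ ∷ u) (here y≈x) | no x≉y = contradiction (≈-sym y≈x) x≉y
    present {x ∷ xs} (x∉ ∷ u) (there y∈) | no x≉y = present u y∈

  -- Turns sums over the rows, or over the columns other than `C`, into weighted sums over the whole
  -- group.
  ∑-members : ∀ (E : DecSubset setoid p) (f : Carrier → ℕ) xs →
    ∑ (members F E xs) (f ∘ proj₁) ≡ ∑ xs (λ x → 𝟙 (DecSubset.member? E x) * f x)
  ∑-members E f []       = refl
  ∑-members E f (x ∷ xs) with DecSubset.member? E x
  ... | yes _ = cong₂ _+_ (sym (*-identityˡ (f x))) (∑-members E f xs)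
  ... | no  _ = ∑-members E f xs

-- Reflections of `D` in the group.

module _ (G : AbelianGroup c ℓ) (finite : IsFinite (AbelianGroup.setoid G))
         (D : DecSubset (AbelianGroup.setoid G) p) where
  open AbelianGroup G
    renaming (refl to ≈-refl; sym to ≈-sym; trans to ≈-trans; setoid to S)
  open AbelianGroupProperties G
  open CommutativeSemigroupProperties commutativeSemigroup using (x∙yz≈y∙xz)
  open IsFinite finite
  open DecSubset D
  private
    F : FiniteSetoid c ℓ
    F = record { setoid = S ; isFinite = finite }

    Y = youdenSquare G finite D

    d : Carrier → ℕ
    d x = 𝟙 (member? x)

    d̅ : Carrier → ℕ
    d̅ x = 𝟙 (¬? (member? x))

    d-cong : ∀ {x y} → x ≈ y → d x ≡ d y
    d-cong x≈y = 𝟙-cong _ _ (resp x≈y) (resp (≈-sym x≈y))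

    d̅-cong : ∀ {x y} → x ≈ y → d̅ x ≡ d̅ y
    d̅-cong x≈y = 𝟙-cong _ _ (_∘ resp (≈-sym x≈y)) (_∘ resp x≈y)

  -- Used with an inverse in place of `y`: it evaluates the occupancy test of row `i` at the column
  -- where a given row holds the symbol i⁻¹gC. Both `i` and `C` drop out, so the count in RTA4
  -- depends on `g` alone.
  cancel-i-C : ∀ i y g C → i ∙ (y ∙ (i ⁻¹ ∙ g ∙ C)) ∙ C ⁻¹ ≈ g ∙ y
  cancel-i-C i y g C = begin
    i ∙ (y ∙ (i ⁻¹ ∙ g ∙ C)) ∙ C ⁻¹    ≈⟨ ∙-congʳ (x∙yz≈y∙xz i y _) ⟩
    y ∙ (i ∙ (i ⁻¹ ∙ g ∙ C)) ∙ C ⁻¹    ≈⟨ ∙-congʳ (∙-congˡ (assoc i (i ⁻¹ ∙ g) C)) ⟨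
    y ∙ (i ∙ (i ⁻¹ ∙ g) ∙ C) ∙ C ⁻¹    ≈⟨ ∙-congʳ (∙-congˡ (∙-congʳ (\\-leftDividesˡ i g))) ⟩
    y ∙ (g ∙ C) ∙ C ⁻¹                 ≈⟨ ∙-congʳ (assoc y g C) ⟨
    y ∙ g ∙ C ∙ C ⁻¹                   ≈⟨ //-rightDividesʳ C (y ∙ g) ⟩
    y ∙ g                              ≈⟨ comm y g ⟩
    g ∙ y                              ∎
    where open SetoidReasoning S

  -- The second condition says that the symbol i⁻¹gC is absent from column `C`, so it survives the
  -- deletion and RTA4 can be applied to it.
  Escapes : Carrier → Carrier → Set p
  Escapes g i = Member i × ¬ Member (i ⁻¹ ∙ g)

  escapes? : ∀ g → Dec (∃ (Escapes g))
  escapes? g = ∃? F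
    (λ i≈i′ (mi , ¬m) → resp i≈i′ mi , ¬m ∘ resp (∙-congʳ (⁻¹-cong (≈-sym i≈i′))))
    (λ i → member? i ×-dec ¬? (member? (i ⁻¹ ∙ g)))

  -- Finiteness makes the case split of the proof constructive; a negative answer yields an escape
  -- for every `g`, since `escapes?` is decidable.
  no-escape? : Dec (∃ λ g → ¬ ∃ (Escapes g))
  no-escape? = ∃? F
    (λ g≈g′ ¬esc (i , mi , ¬m) → ¬esc (i , mi , ¬m ∘ resp (∙-congˡ g≈g′)))
    (λ g → ¬? (escapes? g))

  -- x ↦ x⁻¹g is an involution, so if it maps D into D it maps D onto D.
  no-escape⇒multiplier : ∀ g → ¬ ∃ (Escapes g) → MinusOneIsMultiplier G D
  no-escape⇒multiplier g ¬esc = g ⁻¹ , to , from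
    where
    reflect : ∀ {x} → Member x → Member (x ⁻¹ ∙ g)
    reflect {x} mx = decidable-stable (member? _) (λ ¬m → ¬esc (x , mx , ¬m))

    to : ∀ {z} → inverses G Member z → translate G Member (g ⁻¹) z
    to {z} (x , mx , z≈x⁻¹) = x ⁻¹ ∙ g , reflect mx , ≈-sym (begin
      x ⁻¹ ∙ g ∙ g ⁻¹ ≈⟨ //-rightDividesʳ g (x ⁻¹) ⟩
      x ⁻¹            ≈⟨ z≈x⁻¹ ⟨
      z               ∎)
      where open SetoidReasoning S

    from : ∀ {z} → translate G Member (g ⁻¹) z → inverses G Member z
    from {z} (x , mx , z≈xg⁻¹) = x ⁻¹ ∙ g , reflect mx , ≈-sym (begin
      (x ⁻¹ ∙ g) ⁻¹    ≈⟨ ⁻¹-∙-comm (x ⁻¹) g ⟨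
      x ⁻¹ ⁻¹ ∙ g ⁻¹   ≈⟨ ∙-congʳ (⁻¹-involutive x) ⟩
      x ∙ g ⁻¹         ≈⟨ z≈xg⁻¹ ⟨
      z                ∎)
      where open SetoidReasoning S

  -- Counting pairs of `D` by their quotients.

  private
    W : Carrier → ℕ
    W g = ∑ elements (λ x → d x * d̅ (g ∙ x ⁻¹))

    T : Carrier → ℕ
    T h = ∑ elements (λ x → d x * W (h ∙ x))

    t : ℕ
    t = ∑ elements d̅

    pairs : List (Carrier × Carrier)
    pairs = cartesianProduct elements elements

    d² : Carrier × Carrier → ℕ
    d² (x , y) = d x * d y

    -- The coefficient of `q` in the group ring product D·D⁽⁻¹⁾.
    r : Carrier → ℕ
    r q = ∑ pairs (λ (x , y) → d² (x , y) * 𝟙 (q ≟ (x ∙ y ⁻¹)))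

  -- Translation by `h` is a bijection of the group. The reindexing inserts a variable `x` for hq,
  -- swaps the sums and solves x = hq for `q`, so the enumeration itself is never permuted.
  ∑-translate : ∀ h → ∑ elements (λ q → d̅ (h ∙ q)) ≡ t
  ∑-translate h = begin
    ∑ elements (λ q → d̅ (h ∙ q))
      ≡⟨ ∑-cong elements (λ q → sym (∑-δ F d̅ d̅-cong (h ∙ q))) ⟩
    ∑ elements (λ q → ∑ elements (λ x → 𝟙 (x ≟ (h ∙ q)) * d̅ x))
      ≡⟨ ∑-swap _ elements elements ⟩
    ∑ elements (λ x → ∑ elements (λ q → 𝟙 (x ≟ (h ∙ q)) * d̅ x))
      ≡⟨ ∑-cong elements (λ x → ∑-cong elements (λ q →
           cong (_* d̅ x) (𝟙-cong (x ≟ (h ∙ q)) (q ≟ (h ⁻¹ ∙ x))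
             (λ x≈hq → ≈-trans (≈-sym (\\-leftDividesʳ h q)) (∙-congˡ (≈-sym x≈hq)))
             (λ q≈ → ≈-trans (≈-sym (\\-leftDividesˡ h x)) (∙-congˡ (≈-sym q≈)))))) ⟩
    ∑ elements (λ x → ∑ elements (λ q → 𝟙 (q ≟ (h ⁻¹ ∙ x)) * d̅ x))
      ≡⟨ ∑-cong elements (λ x → ∑-δ F (λ _ → d̅ x) (λ _ → refl) (h ⁻¹ ∙ x)) ⟩
    t ∎
    where open ≡-Reasoning

  -- The summand depends on the pair only through h and xy⁻¹, so the pairs with a common quotient
  -- can be collected.
  T≡∑r : ∀ h → T h ≡ ∑ elements (λ q → d̅ (h ∙ q) * r q)
  T≡∑r h = begin
    T h
      ≡⟨ ∑-cong elements (λ x → sym (*-distribˡ-∑ (d x) _ elements)) ⟩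
    ∑ elements (λ x → ∑ elements (λ y → d x * (d y * d̅ (h ∙ x ∙ y ⁻¹))))
      ≡⟨ ∑-cartesianProduct _ elements elements ⟨
    ∑ pairs (λ (x , y) → d x * (d y * d̅ (h ∙ x ∙ y ⁻¹)))
      ≡⟨ ∑-cong pairs (λ (x , y) → begin
           d x * (d y * d̅ (h ∙ x ∙ y ⁻¹))
             ≡⟨ *-assoc (d x) (d y) _ ⟨
           d² (x , y) * d̅ (h ∙ x ∙ y ⁻¹)
             ≡⟨ cong (d² (x , y) *_) (d̅-cong (assoc h x (y ⁻¹))) ⟩
           d² (x , y) * d̅ (h ∙ (x ∙ y ⁻¹))
             -- The quotient becomes a summation variable `q` of its own, ready to be moved outside
             -- the sum over pairs.
             ≡⟨ cong (d² (x , y) *_)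
                  (∑-δ F (λ q → d̅ (h ∙ q)) (d̅-cong ∘ ∙-congˡ) (x ∙ y ⁻¹)) ⟨
           d² (x , y) * ∑ elements (λ q → 𝟙 (q ≟ (x ∙ y ⁻¹)) * d̅ (h ∙ q))
             ≡⟨ *-distribˡ-∑ (d² (x , y)) _ elements ⟨
           ∑ elements (λ q → d² (x , y) * (𝟙 (q ≟ (x ∙ y ⁻¹)) * d̅ (h ∙ q)))
             ≡⟨ ∑-cong elements (λ q → rotate (d² (x , y)) _ (d̅ (h ∙ q))) ⟩
           ∑ elements (λ q → d̅ (h ∙ q) * (d² (x , y) * 𝟙 (q ≟ (x ∙ y ⁻¹)))) ∎) ⟩
    ∑ pairs (λ (x , y) → ∑ elements (λ q →
      d̅ (h ∙ q) * (d² (x , y) * 𝟙 (q ≟ (x ∙ y ⁻¹)))))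
      ≡⟨ ∑-swap _ pairs elements ⟩
    ∑ elements (λ q → ∑ pairs (λ (x , y) →
      d̅ (h ∙ q) * (d² (x , y) * 𝟙 (q ≟ (x ∙ y ⁻¹)))))
      ≡⟨ ∑-cong elements (λ q → *-distribˡ-∑ (d̅ (h ∙ q)) _ pairs) ⟩
    ∑ elements (λ q → d̅ (h ∙ q) * r q) ∎
    where
    open ≡-Reasoning
    rotate : ∀ l m n → l * (m * n) ≡ n * (l * m)
    rotate = solve-∀

  -- A trivial quotient forces y = x, so only the diagonal remains, where the squared indicator
  -- equals the indicator.
  r-identity : ∀ {q} → q ≈ ε → r q ≡ ∑ elements d
  r-identity {q} q≈ε = begin
    r q
      ≡⟨ ∑-cartesianProduct _ elements elements ⟩
    ∑ elements (λ x → ∑ elements (λ y → d x * d y * 𝟙 (q ≟ (x ∙ y ⁻¹))))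
      ≡⟨ ∑-cong elements (λ x → ∑-cong elements (λ y → trans
           (cong (d x * d y *_) (𝟙-cong (q ≟ (x ∙ y ⁻¹)) (y ≟ x) to from))
           (*-comm (d x * d y) _))) ⟩
    ∑ elements (λ x → ∑ elements (λ y → 𝟙 (y ≟ x) * (d x * d y)))
      ≡⟨ ∑-cong elements (λ x → ∑-δ F (λ y → d x * d y) (cong (d x *_) ∘ d-cong) x) ⟩
    ∑ elements (λ x → d x * d x)
      ≡⟨ ∑-cong elements (λ x → 𝟙-idem (member? x)) ⟩
    ∑ elements d ∎
    where
    open ≡-Reasoning
    to : ∀ {x y} → q ≈ x ∙ y ⁻¹ → y ≈ x
    to {x} {y} q≈ = ≈-sym (x∙y⁻¹≈ε⇒x≈y x y (≈-trans (≈-sym q≈) q≈ε))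
    from : ∀ {x y} → y ≈ x → q ≈ x ∙ y ⁻¹
    from {x} {y} y≈x = ≈-trans q≈ε (≈-sym (x≈y⇒x∙y⁻¹≈ε (≈-sym y≈x)))

  -- Consequences of the difference set axioms.

  module _ {v k lam : ℕ} (ds : IsDifferenceSet G finite D v k lam) where
    open IsDifferenceSet ds

    r-nonidentity : ∀ {q} → ¬ (q ≈ ε) → r q ≡ lam
    r-nonidentity {q} q≉ε = begin
      r q
        ≡⟨ ∑-cong pairs (λ (x , y) → sym (trans (𝟙-× (member? x ×-dec member? y) _)
             (cong (_* 𝟙 (q ≟ (x ∙ y ⁻¹))) (𝟙-× (member? x) (member? y))))) ⟩
      _ ≡⟨ count≡∑ _ pairs ⟨
      _ ≡⟨ differences q q≉ε ⟩
      lam ∎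
      where open ≡-Reasoning

    -- The group ring identity D·D⁽⁻¹⁾ = (k − λ) + λG, applied to the
    -- complement of D, with the negative term moved to the left.
    T-balance : ∀ h → T h + d̅ h * lam ≡ lam * t + d̅ h * k
    T-balance h = begin
      T h + d̅ h * lam
        ≡⟨ cong₂ _+_ (T≡∑r h) (sym (δ-ε lam)) ⟩
      ∑ elements (λ q → d̅ (h ∙ q) * r q)
        + ∑ elements (λ q → 𝟙 (q ≟ ε) * (d̅ (h ∙ q) * lam))
        ≡⟨ ∑-distrib-+ _ _ elements ⟨
      ∑ elements (λ q → d̅ (h ∙ q) * r q + 𝟙 (q ≟ ε) * (d̅ (h ∙ q) * lam))
        ≡⟨ ∑-cong elements pointwise ⟩
      ∑ elements (λ q → lam * d̅ (h ∙ q) + 𝟙 (q ≟ ε) * (d̅ (h ∙ q) * k))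
        ≡⟨ ∑-distrib-+ _ _ elements ⟩
      ∑ elements (λ q → lam * d̅ (h ∙ q))
        + ∑ elements (λ q → 𝟙 (q ≟ ε) * (d̅ (h ∙ q) * k))
        ≡⟨ cong₂ _+_ (trans (*-distribˡ-∑ lam _ elements)
                            (cong (lam *_) (∑-translate h)))
                     (δ-ε k) ⟩
      lam * t + d̅ h * k ∎
      where
      open ≡-Reasoning
      δ-ε : ∀ n → ∑ elements (λ q → 𝟙 (q ≟ ε) * (d̅ (h ∙ q) * n)) ≡ d̅ h * n
      δ-ε n = trans
        (∑-δ F (λ q → d̅ (h ∙ q) * n) (cong (_* n) ∘ d̅-cong ∘ ∙-congˡ) ε)
        (cong (_* n) (d̅-cong (identityʳ h)))

      swap-terms : ∀ l m n → l * m + 1 * (l * n) ≡ n * l + 1 * (l * m)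
      swap-terms = solve-∀

      -- With the correction terms spread out as sums concentrated at `ε`, the identity holds
      -- termwise: at `ε` both sides carry one term with `k` and one with `lam`; elsewhere `r q` is
      -- `lam` and the corrections vanish.
      pointwise : ∀ q → d̅ (h ∙ q) * r q + 𝟙 (q ≟ ε) * (d̅ (h ∙ q) * lam)
                      ≡ lam * d̅ (h ∙ q) + 𝟙 (q ≟ ε) * (d̅ (h ∙ q) * k)
      pointwise q with q ≟ ε
      ... | yes q≈ε rewrite r-identity q≈ε | sym (count≡∑ member? elements) | size≡k =
        swap-terms (d̅ (h ∙ q)) k lam
      ... | no  q≉ε rewrite r-nonidentity q≉ε =
        cong (_+ 0) (*-comm (d̅ (h ∙ q)) lam)

    -- Constancy of `W` makes `T` constant too, while in `T-balance` the factor `d̅` is 0 at `h₁`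
    -- and 1 at `h₂`. Equating the two values of `T` leaves `lam` against `k`.
    W-constant⇒k≡lam : ∀ {ν} → (∀ g → W g ≡ ν) →
                       ∀ {h₁ h₂} → Member h₁ → ¬ Member h₂ → k ≡ lam
    W-constant⇒k≡lam {ν} W≡ν {h₁} {h₂} m₁ ¬m₂ = sym (+-cancelˡ-≡ (lam * t) lam k (begin
      lam * t + lam         ≡⟨ cong (_+ lam) T₁ ⟨
      T h₁ + lam            ≡⟨ cong (_+ lam) (trans (T≡ h₁) (sym (T≡ h₂))) ⟩
      T h₂ + lam            ≡⟨ T₂ ⟩
      lam * t + k           ∎))
      where
      open ≡-Reasoning
      T≡ : ∀ h → T h ≡ ∑ elements (λ x → d x * ν)
      T≡ h = ∑-cong elements (λ x → cong (d x *_) (W≡ν (h ∙ x)))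

      T₁ : T h₁ ≡ lam * t
      T₁ = begin
        T h₁              ≡⟨ +-identityʳ (T h₁) ⟨
        T h₁ + 0          ≡⟨ cong (λ n → T h₁ + n * lam) d̅₁ ⟨
        T h₁ + d̅ h₁ * lam ≡⟨ T-balance h₁ ⟩
        lam * t + d̅ h₁ * k ≡⟨ cong (λ n → lam * t + n * k) d̅₁ ⟩
        lam * t + 0       ≡⟨ +-identityʳ (lam * t) ⟩
        lam * t           ∎
        where
        d̅₁ : d̅ h₁ ≡ 0
        d̅₁ = 𝟙-no (¬? (member? h₁)) (λ ¬m → ¬m m₁)

      T₂ : T h₂ + lam ≡ lam * t + k
      T₂ = begin
        T h₂ + lam          ≡⟨ cong (T h₂ +_) (*-identityˡ lam) ⟨
        T h₂ + 1 * lam      ≡⟨ cong (λ n → T h₂ + n * lam) d̅₂ ⟨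
        T h₂ + d̅ h₂ * lam   ≡⟨ T-balance h₂ ⟩
        lam * t + d̅ h₂ * k  ≡⟨ cong (λ n → lam * t + n * k) d̅₂ ⟩
        lam * t + 1 * k     ≡⟨ cong (lam * t +_) (*-identityˡ k) ⟩
        lam * t + k         ∎
        where
        d̅₂ : d̅ h₂ ≡ 1
        d̅₂ = 𝟙-yes (¬? (member? h₂)) ¬m₂

  -- The triple array condition expressed in the group.

  module _ (C : Carrier) (rl : IsRLTripleArray (deleteColumn Y C)) where
    open IsRLTripleArray rl using (λrc; RTA4)
    private
      module R = FiniteSetoid (subset F D)
      module O = FiniteSetoid (OtherCols Y C)
      open Array (deleteColumn Y C)

    -- Column `C` holds the symbols iC with i in `D`, so the only possible row for `x` is xC⁻¹. With
    -- its converse this makes survival of a symbol a membership test in `D`.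
    appears⇒member : ∀ {x} → Array.Appears Y C x → Member (x ∙ C ⁻¹)
    appears⇒member {x} ((i , mi) , MaybeAny.just iC≈x) =
      resp (≈-trans (≈-sym (//-rightDividesʳ C i)) (∙-congʳ iC≈x)) mi

    member⇒appears : ∀ {x} → Member (x ∙ C ⁻¹) → Array.Appears Y C x
    member⇒appears {x} m = (x ∙ C ⁻¹ , m) , MaybeAny.just (//-rightDividesˡ C x)

    occupied⇒ : ∀ i j → Occupied i j → ¬ Member (proj₁ i ∙ proj₁ j ∙ C ⁻¹)
    occupied⇒ (i , _) (j , _) occ with Array.appears? Y C (i ∙ j)
    ... | no  ij∉ = ij∉ ∘ member⇒appears

    occupied⇐ : ∀ i j → ¬ Member (proj₁ i ∙ proj₁ j ∙ C ⁻¹) → Occupied i j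
    occupied⇐ (i , _) (j , _) ¬m with Array.appears? Y C (i ∙ j)
    ... | yes ij∈ = contradiction (appears⇒member ij∈) ¬m
    ... | no  _   = MaybeAny.just tt

    contains⇒ : ∀ i j x → Contains i j x → proj₁ i ∙ proj₁ j ≈ proj₁ x
    contains⇒ (i , _) (j , _) _ con with Array.appears? Y C (i ∙ j) | con
    ... | no _ | MaybeAny.just ij≈x = ij≈x

    contains⇐ : ∀ i j x → proj₁ i ∙ proj₁ j ≈ proj₁ x → Contains i j x
    contains⇐ (i , _) (j , _) (x , x∉) ij≈x with Array.appears? Y C (i ∙ j)
    ... | yes ij∈ = contradiction (Array.Appears-resp Y C ij≈x ij∈) x∉
    ... | no  _   = MaybeAny.just ij≈x

    -- In `Y` each row y holds the symbol `x` in the single column y⁻¹x, and row `i` is occupied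
    -- there exactly when gy⁻¹ lies outside `D`. Summing over the rows y in `D` gives `W g`.
    RTA4⇒W≡λrc : ∀ {g i} → Escapes g i → W g ≡ λrc
    RTA4⇒W≡λrc {g} {i} (mi , ¬m) = sym (begin
      λrc
        ≡⟨ RTA4 (i , mi) (x , x∉) ⟨
      _ ≡⟨ count≡∑ _ (cartesianProduct R.elements O.elements) ⟩
      _ ≡⟨ ∑-cong (cartesianProduct R.elements O.elements) (λ (i′ , j) → trans
             (𝟙-× (occupied? (i , mi) j) (contains? i′ j (x , x∉)))
             (cong₂ _*_
               (𝟙-cong (occupied? (i , mi) j) (¬? (member? _))
                 (occupied⇒ (i , mi) j) (occupied⇐ (i , mi) j))
               (𝟙-cong (contains? i′ j (x , x∉)) (_ ≟ _)
                 (contains⇒ i′ j (x , x∉)) (contains⇐ i′ j (x , x∉))))) ⟩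
      ∑ (cartesianProduct R.elements O.elements)
        (λ (i′ , j) → e (proj₁ i′) (proj₁ j))
        ≡⟨ ∑-cartesianProduct _ R.elements O.elements ⟩
      ∑ R.elements (λ i′ → ∑ O.elements (λ j → e (proj₁ i′) (proj₁ j)))
        ≡⟨ ∑-members F D (λ y → ∑ O.elements (λ j → e y (proj₁ j))) elements ⟩
      ∑ elements (λ y → d y * ∑ O.elements (λ j → e y (proj₁ j)))
        ≡⟨ ∑-cong elements (λ y → cong (d y *_) (column-sum y)) ⟩
      W g ∎)
      where
      open ≡-Reasoning
      -- Chosen so that ix = gC.
      x : Carrier
      x = i ⁻¹ ∙ g ∙ C

      x∉ : ¬ Array.Appears Y C x
      x∉ x∈ = ¬m (resp (//-rightDividesʳ C (i ⁻¹ ∙ g)) (appears⇒member x∈))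

      e : Carrier → Carrier → ℕ
      e y j = d̅ (i ∙ j ∙ C ⁻¹) * 𝟙 ((y ∙ j) ≟ x)

      -- At j = C the test element iCC⁻¹ = i is in `D`, so the summand is already 0 and the sum may
      -- run over all columns.
      drop-C : ∀ j → 𝟙 (¬? (j ≟ C)) * d̅ (i ∙ j ∙ C ⁻¹) ≡ d̅ (i ∙ j ∙ C ⁻¹)
      drop-C j with j ≟ C
      ... | no  _   = *-identityˡ _
      ... | yes j≈C = sym (𝟙-no (¬? (member? _)) (λ ¬m′ → ¬m′ (resp
        (≈-trans (≈-sym (//-rightDividesʳ C i)) (∙-congʳ (∙-congˡ (≈-sym j≈C)))) mi)))

      column-sum : ∀ y → ∑ O.elements (λ j → e y (proj₁ j)) ≡ d̅ (g ∙ y ⁻¹)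
      column-sum y = begin
        ∑ O.elements (λ j → e y (proj₁ j))
          ≡⟨ ∑-members F _ (e y) elements ⟩
        ∑ elements (λ j → 𝟙 (¬? (j ≟ C)) * e y j)
          ≡⟨ ∑-cong elements (λ j → begin
               𝟙 (¬? (j ≟ C)) * (d̅ (i ∙ j ∙ C ⁻¹) * 𝟙 ((y ∙ j) ≟ x))
                 ≡⟨ *-assoc (𝟙 (¬? (j ≟ C))) _ _ ⟨
               𝟙 (¬? (j ≟ C)) * d̅ (i ∙ j ∙ C ⁻¹) * 𝟙 ((y ∙ j) ≟ x)
                 ≡⟨ cong₂ _*_ (drop-C j) (𝟙-cong ((y ∙ j) ≟ x) (j ≟ (y ⁻¹ ∙ x))
                      (λ yj≈x → ≈-trans (≈-sym (\\-leftDividesʳ y j)) (∙-congˡ yj≈x))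
                      (λ j≈ → ≈-trans (∙-congˡ j≈) (\\-leftDividesˡ y x))) ⟩
               d̅ (i ∙ j ∙ C ⁻¹) * 𝟙 (j ≟ (y ⁻¹ ∙ x))
                 ≡⟨ *-comm (d̅ (i ∙ j ∙ C ⁻¹)) _ ⟩
               𝟙 (j ≟ (y ⁻¹ ∙ x)) * d̅ (i ∙ j ∙ C ⁻¹) ∎) ⟩
        ∑ elements (λ j → 𝟙 (j ≟ (y ⁻¹ ∙ x)) * d̅ (i ∙ j ∙ C ⁻¹))
          ≡⟨ ∑-δ F (λ j → d̅ (i ∙ j ∙ C ⁻¹)) (d̅-cong ∘ ∙-congʳ ∘ ∙-congˡ) (y ⁻¹ ∙ x) ⟩
        d̅ (i ∙ (y ⁻¹ ∙ x) ∙ C ⁻¹)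
          ≡⟨ d̅-cong (cancel-i-C i (y ⁻¹) g C) ⟩
        d̅ (g ∙ y ⁻¹) ∎

theorem3p7 : ∀ {c ℓ p} (G : AbelianGroup c ℓ) (finite : IsFinite (AbelianGroup.setoid G))
    (D : DecSubset (AbelianGroup.setoid G) p) (v k lam : ℕ) →
    IsDifferenceSet G finite D v k lam →
    k ∸ lam > 1 →
    (C : AbelianGroup.Carrier G) →
    IsRLTripleArray (deleteColumn (youdenSquare G finite D) C) →
    MinusOneIsMultiplier G D
theorem3p7 G finite D v k lam ds k∸lam>1 C rl with no-escape? G finite D
... | yes (g , ¬esc) = no-escape⇒multiplier G finite D g ¬esc
... | no  ¬∃         = contradiction k≡lam k≢lam
  where
  escape : ∀ g → ∃ (Escapes G finite D g)
  escape g = decidable-stable (escapes? G finite D g) (λ ¬esc → ¬∃ (g , ¬esc))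

  k≡lam : k ≡ lam
  -- The escape at `ε` supplies both an element of `D` and one outside it. The rows and symbols
  -- chosen for different `g` vary, but all give the same `λrc`.
  k≡lam with i , mi , ¬m ← escape (AbelianGroup.ε G) =
    W-constant⇒k≡lam G finite D ds
      (λ g → RTA4⇒W≡λrc G finite D C rl (proj₂ (escape g))) mi ¬m

  -- If k = λ, the truncated difference is 0, which is not greater than 1.
  k≢lam : ¬ (k ≡ lam)
  k≢lam refl = contradiction (≤-trans k∸lam>1 (≤-reflexive (n∸n≡0 k))) λ ()
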